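{- Let $G$ be a complete split graph with partition $(K,S)$, $K\neq\emptyset$, whose vertices are each colored $A$, $B$ or $C$. If every vertex of $K$ has color $A$ (resp. $B$), then the Normal Partizan Domination game on $G$ has the same value as the game on the star whose leaves are the vertices of $S$ (with their colors) and whose center has color $A$ (resp. $B$). Otherwise, the game on $G$ has the same value as the game on that star with center colored $C$.
   Context: A complete split graph is a graph $G$ whose vertex set has a partition $(K,S)$ such that $K$ induces a clique, $S$ is an independent set, and every vertex of $K$ is adjacent to every vertex of $S$. Normal Partizan Domination game: a finite graph has each vertex colored $A$, $B$ or $C$. Alice and Bob alternately select a vertex; Alice may only select vertices colored $A$ or $C$, Bob only vertices colored $B$ or $C$. A vertex $u$ dominates $v$ if $u=v$ or $uv$ is an edge. A vertex may be selected only if it is playable, i.e. it dominates at least one vertex not dominated by the previously selected vertices; the game ends when the selected vertices form a dominating set. Under normal play the player unable to move loses. The game is regarded as a partizan combinatorial game with Alice as Left and Bob as Right, and its value is its value in Conway's combinatorial game theory ($G=H$ iff $G+(-H)$ is a second-player win). -}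

module Defs where

open import Data.Fin using (Fin; zero; suc)
open import Data.Fin.Subset using (Subset; _∈_; _⊂_; _⊃_; _∪_; ⁅_⁆; ∁; ⊥)
open import Data.Fin.Subset.Induction using (Acc; acc; ⊃-wellFounded)
open import Data.Fin.Subset.Properties using (p⊆p∪q; q⊆p∪q; x∈⁅x⁆)
open import Data.Nat using (ℕ; suc)
open import Data.Product using (∃; _×_; _,_)
open import Data.Sum using (_⊎_; [_,_])
open import Level using (0ℓ)
open import Relation.Binary using (Rel; Symmetric; Irreflexive; Decidable)
open import Relation.Binary.PropositionalEquality using (_≡_; _≢_; refl)
open import Relation.Nullary using (¬_; yes; no)

-- Alice is Left and Bob is Right.

data Player : Set where
  Alice Bob : Player

opponent : Player → Player
opponent Alice = Bob
opponent Bob   = Alice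

-- Conway's partizan games.  The options of a player are an indexed family,
-- so the same option may be listed several times.

data Game : Set₁ where
  node : (Option : Player → Set) → (∀ p → Option p → Game) → Game

infix  8 -_
infixl 6 _+_
infix  4 _≈_

-_ : Game → Game
- node O move = node (λ p → O (opponent p)) (λ p o → - move (opponent p) o)

_+_ : Game → Game → Game
g@(node O move) + h@(node O′ move′) = node
  (λ p → O p ⊎ O′ p)
  (λ p → [ (λ o → move p o + h) , (λ o → g + move′ p o) ])

-- Normal play: a player who has to move and has no option loses.

WinsMovingFirst WinsMovingSecond : Player → Game → Set
WinsMovingFirst  p (node O move) = ∃ λ (o : O p) → WinsMovingSecond p (move p o)
WinsMovingSecond p (node O move) =
  (o : O (opponent p)) → WinsMovingFirst p (move (opponent p) o)

SecondPlayerWin : Game → Set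
SecondPlayerWin g = ∀ p → WinsMovingSecond p g

_≈_ : Game → Game → Set
g ≈ h = SecondPlayerWin (g + - h)

record Graph (n : ℕ) : Set₁ where
  field
    Adj         : Rel (Fin n) 0ℓ
    adj?        : Decidable Adj
    symmetric   : Symmetric Adj
    irreflexive : Irreflexive _≡_ Adj

record CompleteSplit {n} (G : Graph n) (K S : Subset n) : Set where
  open Graph G
  field
    partition   : S ≡ ∁ K
    clique      : ∀ {u v} → u ∈ K → v ∈ K → u ≢ v → Adj u v
    independent : ∀ {u v} → u ∈ S → v ∈ S → ¬ Adj u v
    join        : ∀ {u v} → u ∈ K → v ∈ S → Adj u v

-- The star with m leaves; its centre is zero.

data StarAdj {m} : Rel (Fin (suc m)) 0ℓ where
  centre-leaf : ∀ i → StarAdj zero (suc i)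
  leaf-centre : ∀ i → StarAdj (suc i) zero

star : ∀ m → Graph (suc m)
star m = record
  { Adj         = StarAdj
  ; adj?        = λ where
      zero    zero    → no λ ()
      zero    (suc i) → yes (centre-leaf i)
      (suc i) zero    → yes (leaf-centre i)
      (suc i) (suc j) → no λ ()
  ; symmetric   = λ where
      (centre-leaf i) → leaf-centre i
      (leaf-centre i) → centre-leaf i
  ; irreflexive = λ where refl ()
  }

data Colour : Set where
  A B C : Colour

data _MaySelect_ : Player → Colour → Set where
  Alice-A : Alice MaySelect A
  Alice-C : Alice MaySelect C
  Bob-B   : Bob MaySelect B
  Bob-C   : Bob MaySelect C

module _ {n} (G : Graph n) where
  open Graph G

  Dominates : Rel (Fin n) 0ℓ
  Dominates u v = u ≡ v ⊎ Adj u v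

  DominatedBy : Subset n → Fin n → Set
  DominatedBy P w = ∃ λ u → u ∈ P × Dominates u w

  -- P is the set of vertices selected so far.
  Playable : Subset n → Fin n → Set
  Playable P v = ∃ λ w → Dominates v w × ¬ DominatedBy P w

  playable-⊂ : ∀ {P v} → Playable P v → P ⊂ P ∪ ⁅ v ⁆
  playable-⊂ {P} {v} (w , v-dom-w , w-undominated) =
    p⊆p∪q ⁅ v ⁆ , v , q⊆p∪q P ⁅ v ⁆ (x∈⁅x⁆ v) ,
    λ v∈P → w-undominated (v , v∈P , v-dom-w)

  module _ (colour : Fin n → Colour) where

    -- Once P is a dominating set no vertex is playable, so the end of the
    -- game needs no separate clause.
    positionGame : (P : Subset n) → Acc _⊃_ P → Game
    positionGame P (acc rec) = node
      (λ p → ∃ λ v → p MaySelect colour v × Playable P v)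
      (λ p (v , _ , playable) →
        positionGame (P ∪ ⁅ v ⁆) (rec (playable-⊂ playable)))

    dominationGame : Game
    dominationGame = positionGame ⊥ (⊃-wellFounded ⊥)

{-# OPTIONS --safe #-}

-- Collapsing K to a single vertex sends G onto the star, and u dominates w in
-- G exactly when the image of u dominates the image of w.  A position of the
-- game on G and its image therefore have the same moves up to repetition, so
-- the two games are bisimilar, and copying the opponent's moves wins their
-- difference moving second.

module Submission where

open import Defs
open import Data.Fin using (Fin; zero; suc)
open import Data.Fin.Properties using (any?; _≟_; suc-injective)
open import Data.Fin.Subset using (Subset; _∈_; Nonempty; _∪_; ⁅_⁆; ⊥; _⊃_)
open import Data.Fin.Subset.Induction using (Acc; acc; ⊃-wellFounded)
open import Data.Fin.Subset.Properties
  using (_∈?_; ∉⊥; x∈⁅x⁆; x∈⁅y⁆⇒x≡y; x∈p∪q⁺; x∈p∪q⁻; x∉p⇒x∈∁p; x∈∁p⇒x∉p)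
open import Data.Nat using (suc)
open import Data.Product using (∃; _×_; _,_; proj₁; proj₂)
open import Data.Sum using (_⊎_; inj₁; inj₂)
open import Data.Vec.Functional using (_∷_)
open import Data.Vec.Properties.WithK using ([]=-irrelevant)
open import Function.Base using (_∘_)
open import Function.Bundles using (_↔_; Inverse; _⇔_; mk⇔; Equivalence)
open import Relation.Binary.PropositionalEquality
  using (_≡_; refl; sym; trans; cong; subst)
open import Relation.Nullary using (¬_; Dec; yes; no; contradiction; _×-dec_)

-- Bisimilar games have equal values.

infix 4 _∼_

-- A bisimulation and not a bijection of options: several vertices of a clique become one vertex of
-- the star, so one option may answer many.
_∼_ : Game → Game → Set
node O move ∼ node O′ move′ = ∀ p →
  (∀ o → ∃ λ o′ → move p o ∼ move′ p o′) ×
  (∀ o′ → ∃ λ o → move p o ∼ move′ p o′)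

-- `_+_` matches on both summands, so a sum with a variable summand does not reduce. Splitting that
-- summand here exposes the options of the sum.
+-winsˡ : ∀ {O move} h p (o : O p) →
          WinsMovingSecond p (move p o + h) → WinsMovingFirst p (node O move + h)
+-winsˡ (node _ _) p o win = inj₁ o , win

+-winsʳ : ∀ g {O move} p (o : O p) →
          WinsMovingSecond p (g + move p o) → WinsMovingFirst p (g + node O move)
+-winsʳ (node _ _) p o win = inj₂ o , win

∼⇒≈ : ∀ g h → g ∼ h → g ≈ h
∼⇒≈ (node O move) (node O′ move′) g∼h Alice (inj₁ o) =
  let o′ , rel = proj₁ (g∼h Bob) o
  in +-winsʳ (move Bob o) Alice o′ (∼⇒≈ _ _ rel Alice)
∼⇒≈ (node O move) (node O′ move′) g∼h Alice (inj₂ o′) =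
  -- Negation swaps the players: this move of Bob in `- h` is an option of Alice in `h`, so Alice
  -- copies it in `g` as her own.
  let o , rel = proj₂ (g∼h Alice) o′
  in +-winsˡ (- move′ Alice o′) Alice o (∼⇒≈ _ _ rel Alice)
∼⇒≈ (node O move) (node O′ move′) g∼h Bob (inj₁ o) =
  let o′ , rel = proj₁ (g∼h Alice) o
  in +-winsʳ (move Alice o) Bob o′ (∼⇒≈ _ _ rel Bob)
∼⇒≈ (node O move) (node O′ move′) g∼h Bob (inj₂ o′) =
  let o , rel = proj₂ (g∼h Bob) o′
  in +-winsˡ (- move′ Bob o′) Bob o (∼⇒≈ _ _ rel Bob)

-- Positions and their direct images.

module _ {n m} (f : Fin n → Fin m) where

  IsImage : Subset n → Subset m → Set
  IsImage P Q = (∀ {u} → u ∈ P → f u ∈ Q) ×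
                (∀ {y} → y ∈ Q → ∃ λ u → u ∈ P × f u ≡ y)

  image-⊥ : IsImage ⊥ ⊥
  image-⊥ = (λ u∈⊥ → contradiction u∈⊥ ∉⊥) , (λ y∈⊥ → contradiction y∈⊥ ∉⊥)

  image-∪⁅⁆ : ∀ {P Q} v → IsImage P Q → IsImage (P ∪ ⁅ v ⁆) (Q ∪ ⁅ f v ⁆)
  image-∪⁅⁆ {P} {Q} v (into , onto) = into′ , onto′
    where
    into′ : ∀ {u} → u ∈ P ∪ ⁅ v ⁆ → f u ∈ Q ∪ ⁅ f v ⁆
    into′ u∈ with x∈p∪q⁻ P ⁅ v ⁆ u∈
    ... | inj₁ u∈P = x∈p∪q⁺ (inj₁ (into u∈P))
    ... | inj₂ u∈⁅v⁆ with refl ← x∈⁅y⁆⇒x≡y v u∈⁅v⁆ = x∈p∪q⁺ (inj₂ (x∈⁅x⁆ (f v)))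

    onto′ : ∀ {y} → y ∈ Q ∪ ⁅ f v ⁆ → ∃ λ u → u ∈ P ∪ ⁅ v ⁆ × f u ≡ y
    onto′ y∈ with x∈p∪q⁻ Q ⁅ f v ⁆ y∈
    ... | inj₁ y∈Q = let u , u∈P , fu≡y = onto y∈Q in u , x∈p∪q⁺ (inj₁ u∈P) , fu≡y
    ... | inj₂ y∈⁅fv⁆ = v , x∈p∪q⁺ (inj₂ (x∈⁅x⁆ v)) , sym (x∈⁅y⁆⇒x≡y (f v) y∈⁅fv⁆)

module _ {n m} (G : Graph n) (H : Graph m) (f : Fin n → Fin m)
  (surjective : ∀ y → ∃ λ v → f v ≡ y)
  (dominates : ∀ u w → Dominates G u w ⇔ Dominates H (f u) (f w))
  where

  dominatedBy-image : ∀ {P Q} → IsImage f P Q → ∀ w →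
                      DominatedBy G P w ⇔ DominatedBy H Q (f w)
  dominatedBy-image (into , onto) w = mk⇔
    (λ (u , u∈P , u-dom-w) → f u , into u∈P , Equivalence.to (dominates u w) u-dom-w)
    (λ (y , y∈Q , y-dom-fw) → let u , u∈P , fu≡y = onto y∈Q in
      u , u∈P , Equivalence.from (dominates u w)
        (subst (λ z → Dominates H z (f w)) (sym fu≡y) y-dom-fw))

  -- Domination is preserved and reflected, hence so is being undominated. Surjectivity of `f` lifts
  -- the undominated vertex that witnesses playability in `H`.
  playable-image : ∀ {P Q} → IsImage f P Q → ∀ v →
                   Playable G P v ⇔ Playable H Q (f v)
  playable-image {P} {Q} image v = mk⇔
    (λ (w , v-dom-w , undominated) →
      f w , Equivalence.to (dominates v w) v-dom-w , undominated ∘ Equivalence.from (dominatedBy-image image w))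
    from
    where
    from : Playable H Q (f v) → Playable G P v
    from (y , fv-dom-y , undominated) with surjective y
    ... | w , refl =
      w , Equivalence.from (dominates v w) fv-dom-y , undominated ∘ Equivalence.to (dominatedBy-image image w)

  module _ (colourG : Fin n → Colour) (colourH : Fin m → Colour)
    (maySelect-image : ∀ {p} v → p MaySelect colourG v → p MaySelect colourH (f v))
    (maySelect-lift : ∀ {p} y → p MaySelect colourH y →
                      ∃ λ v → f v ≡ y × p MaySelect colourG v)
    where

    -- Playability of `v` depends only on `f v`, so any vertex of the fibre that the player may
    -- select lifts a move. The two accessibility proofs are arbitrary and are consumed in parallel.
    positionGame-image : ∀ {P Q} → IsImage f P Q → (a : Acc _⊃_ P) (b : Acc _⊃_ Q) →
                         positionGame G colourG P a ∼ positionGame H colourH Q b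
    positionGame-image {P} {Q} image (acc rec) (acc rec′) p = forth , back
      where
      forth : ∀ o → ∃ λ o′ → _
      forth (v , select , playable) =
        (f v , maySelect-image v select ,
          Equivalence.to (playable-image image v) playable) ,
        positionGame-image (image-∪⁅⁆ f v image) (rec _) (rec′ _)

      back : ∀ o′ → ∃ λ o → _
      back (y , select , playable) with maySelect-lift y select
      ... | v , refl , select′ =
        (v , select′ , Equivalence.from (playable-image image v) playable) ,
        positionGame-image (image-∪⁅⁆ f v image) (rec _) (rec′ _)

    dominationGame-image : dominationGame G colourG ≈ dominationGame H colourH
    dominationGame-image =
      ∼⇒≈ _ _ (positionGame-image (image-⊥ f) (⊃-wellFounded ⊥) (⊃-wellFounded ⊥))

-- Which players can select in the clique.

maySelect? : ∀ p c → Dec (p MaySelect c)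
maySelect? Alice A = yes Alice-A
maySelect? Alice B = no λ ()
maySelect? Alice C = yes Alice-C
maySelect? Bob   A = no λ ()
maySelect? Bob   B = yes Bob-B
maySelect? Bob   C = yes Bob-C

¬Alice⇒B : ∀ {c} → ¬ (Alice MaySelect c) → c ≡ B
¬Alice⇒B {A} ¬select = contradiction Alice-A ¬select
¬Alice⇒B {B} _       = refl
¬Alice⇒B {C} ¬select = contradiction Alice-C ¬select

¬Bob⇒A : ∀ {c} → ¬ (Bob MaySelect c) → c ≡ A
¬Bob⇒A {A} _       = refl
¬Bob⇒A {B} ¬select = contradiction Bob-B ¬select
¬Bob⇒A {C} ¬select = contradiction Bob-C ¬select

maySelect-C : ∀ p → p MaySelect C
maySelect-C Alice = Alice-C
maySelect-C Bob   = Bob-C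

module _ {n} (colour : Fin n → Colour) (K : Subset n) where

  SelectableIn : Player → Set
  SelectableIn p = ∃ λ v → v ∈ K × p MaySelect colour v

  -- If `p` can select nothing in `K`, every vertex there has the one colour barred to `p`.
  -- Searching the finitely many vertices turns the negated universal into a witness.
  selectableIn : ∀ {c} p → (∀ {x} → ¬ (p MaySelect x) → x ≡ c) →
                 ¬ (∀ v → v ∈ K → colour v ≡ c) → SelectableIn p
  selectableIn p barred ¬all
    with any? (λ v → v ∈? K ×-dec maySelect? p (colour v))
  ... | yes found = found
  ... | no none = contradiction (λ v v∈K → barred λ s → none (v , v∈K , s)) ¬all

-- The collapse of the clique to the centre of a star.

module Collapse {n} (G : Graph n) {K S : Subset n} (split : CompleteSplit G K S)
  (k : Nonempty K) {m} (leaf : Fin m ↔ (∃ λ v → v ∈ S)) where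

  open CompleteSplit split
  open Inverse leaf using (to; from; strictlyInverseˡ; strictlyInverseʳ)

  side : ∀ v → v ∈ K ⊎ v ∈ S
  side v with v ∈? K
  ... | yes v∈K = inj₁ v∈K
  ... | no  v∉K = inj₂ (subst (v ∈_) (sym partition) (x∉p⇒x∈∁p v∉K))

  disjoint : ∀ {v} → v ∈ K → ¬ (v ∈ S)
  disjoint v∈K v∈S = x∈∁p⇒x∉p (subst (_ ∈_) partition v∈S) v∈K

  collapse : Fin n → Fin (suc m)
  collapse v with side v
  ... | inj₁ _   = zero
  ... | inj₂ v∈S = suc (from (v , v∈S))

  collapse-K : ∀ {v} → v ∈ K → collapse v ≡ zero
  collapse-K {v} v∈K with side v
  ... | inj₁ _   = refl
  ... | inj₂ v∈S = contradiction v∈S (disjoint v∈K)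

  collapse-leaf : ∀ i → collapse (proj₁ (to i)) ≡ suc i
  collapse-leaf i with side (proj₁ (to i))
  ... | inj₁ v∈K = contradiction (proj₂ (to i)) (disjoint v∈K)
  -- The membership proof found by `side` need not be the one stored in `to i`; the two are
  -- identified before the round trip applies.
  ... | inj₂ v∈S = cong suc (trans
    (cong (λ s → from (proj₁ (to i) , s)) ([]=-irrelevant v∈S (proj₂ (to i))))
    (strictlyInverseʳ i))

  collapse-surjective : ∀ y → ∃ λ v → collapse v ≡ y
  collapse-surjective zero    = proj₁ k , collapse-K (proj₂ k)
  collapse-surjective (suc i) = proj₁ (to i) , collapse-leaf i

  from-injective : ∀ {u w} {u∈S : u ∈ S} {w∈S : w ∈ S} →
                   from (u , u∈S) ≡ from (w , w∈S) → u ≡ w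
  from-injective eq =
    cong proj₁ (trans (sym (strictlyInverseˡ _)) (trans (cong to eq) (strictlyInverseˡ _)))

  collapse-dominates : ∀ u w →
    Dominates G u w ⇔ Dominates (star m) (collapse u) (collapse w)
  collapse-dominates u w = mk⇔ forth back
    where
    open Graph G

    forth : Dominates G u w → Dominates (star m) (collapse u) (collapse w)
    forth (inj₁ refl) = inj₁ refl
    forth (inj₂ adj) with side u | side w
    ... | inj₁ _   | inj₁ _   = inj₁ refl
    ... | inj₁ _   | inj₂ _   = inj₂ (centre-leaf _)
    ... | inj₂ _   | inj₁ _   = inj₂ (leaf-centre _)
    ... | inj₂ u∈S | inj₂ w∈S = contradiction adj (independent u∈S w∈S)

    back : Dominates (star m) (collapse u) (collapse w) → Dominates G u w
    back dom with side u | side w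
    ... | inj₁ u∈K | inj₂ w∈S = inj₂ (join u∈K w∈S)
    ... | inj₂ u∈S | inj₁ w∈K = inj₂ (symmetric (join w∈K u∈S))
    -- Leaves are pairwise nonadjacent, so one dominates another only by equality.
    back (inj₁ eq) | inj₂ u∈S | inj₂ w∈S = inj₁ (from-injective (suc-injective eq))
    -- Both vertices map to the centre, which says nothing about `u ≡ w`; if they differ, the clique
    -- supplies the edge.
    back dom | inj₁ u∈K | inj₁ w∈K with u ≟ w
    ... | yes u≡w = inj₁ u≡w
    ... | no  u≢w = inj₂ (clique u∈K w∈K u≢w)

  module _ (colour : Fin n → Colour) (x : Colour)
    (centre-selectable : ∀ {p v} → v ∈ K → p MaySelect colour v → p MaySelect x)
    (K-selectable : ∀ {p} → p MaySelect x → SelectableIn colour K p) where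

    private
      starColour : Fin (suc m) → Colour
      starColour = x ∷ λ i → colour (proj₁ (to i))

    maySelect-collapse : ∀ {p} v →
      p MaySelect colour v → p MaySelect starColour (collapse v)
    maySelect-collapse {p} v select with side v
    ... | inj₁ v∈K = centre-selectable v∈K select
    ... | inj₂ v∈S =
      subst (λ w → p MaySelect colour w) (sym (cong proj₁ (strictlyInverseˡ (v , v∈S)))) select

    maySelect-lift : ∀ {p} y → p MaySelect starColour y →
                     ∃ λ v → collapse v ≡ y × p MaySelect colour v
    maySelect-lift zero select =
      let v , v∈K , select′ = K-selectable select in v , collapse-K v∈K , select′
    maySelect-lift (suc i) select = proj₁ (to i) , collapse-leaf i , select

    -- Together the hypotheses on `x` say that the centre is open to exactly the players who can
    -- select some vertex of `K`.
    dominationGame-collapse :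
      dominationGame G colour ≈ dominationGame (star m) starColour
    dominationGame-collapse =
      dominationGame-image G (star m) collapse collapse-surjective collapse-dominates
        colour starColour maySelect-collapse maySelect-lift

theorem10 :
  ∀ {n} (G : Graph n) (colour : Fin n → Colour) {K S : Subset n} →
  CompleteSplit G K S → Nonempty K →
  -- Any labelling of the vertices of S as the leaves of a star.
  ∀ {m} (leaf : Fin m ↔ (∃ λ v → v ∈ S)) →
  let AllOfK : Colour → Set
      AllOfK x = ∀ v → v ∈ K → colour v ≡ x
      starWithCentre : Colour → Game
      starWithCentre x =
        dominationGame (star m) (x ∷ λ i → colour (proj₁ (Inverse.to leaf i)))
  in (AllOfK A → dominationGame G colour ≈ starWithCentre A)
   × (AllOfK B → dominationGame G colour ≈ starWithCentre B)
   × (¬ AllOfK A → ¬ AllOfK B → dominationGame G colour ≈ starWithCentre C)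
theorem10 G colour {K} split k leaf =
    (λ all → dominationGame-collapse colour A (monochrome all) (atK all))
  , (λ all → dominationGame-collapse colour B (monochrome all) (atK all))
  , (λ ¬allA ¬allB → dominationGame-collapse colour C
      (λ {p} _ _ → maySelect-C p)
      (λ {p} _ → mixed ¬allA ¬allB p))
  where
  open Collapse G split k leaf

  monochrome : ∀ {c} → (∀ v → v ∈ K → colour v ≡ c) →
               ∀ {p v} → v ∈ K → p MaySelect colour v → p MaySelect c
  monochrome all {p} v∈K = subst (p MaySelect_) (all _ v∈K)

  atK : ∀ {c} → (∀ v → v ∈ K → colour v ≡ c) →
        ∀ {p} → p MaySelect c → SelectableIn colour K p
  atK all {p} select =
    proj₁ k , proj₂ k , subst (p MaySelect_) (sym (all _ (proj₂ k))) select

  -- Alice is barred only from `B` and Bob only from `A`, so each uses the other's hypothesis. The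
  -- two may need different vertices: `K` need not contain colour `C` for the centre to receive it.
  mixed : ¬ (∀ v → v ∈ K → colour v ≡ A) → ¬ (∀ v → v ∈ K → colour v ≡ B) →
          ∀ p → SelectableIn colour K p
  mixed ¬allA ¬allB Alice = selectableIn colour K Alice ¬Alice⇒B ¬allB
  mixed ¬allA ¬allB Bob   = selectableIn colour K Bob   ¬Bob⇒A   ¬allA
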